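{- Let $G$ be a finite non-cyclic group. Then the following conditions are equivalent: (i) the non-cyclic graph $\Gamma(G)$ admits a perfect code; (ii) $\Gamma(G)$ has a dominating vertex; (iii) $G$ has a maximal cyclic subgroup of order $2$.
   Context: For a finite non-cyclic group $G$, $\mathrm{Cyc}(G)=\{x\in G:\langle x,y\rangle\text{ is cyclic for all }y\in G\}$. The non-cyclic graph $\Gamma(G)$ is the simple undirected graph with vertex set $G\setminus\mathrm{Cyc}(G)$ in which two distinct vertices $x,y$ are adjacent if and only if the subgroup $\langle x,y\rangle$ is not cyclic. A perfect code of a graph $\Gamma$ is an independent set $C\subseteq V(\Gamma)$ such that every vertex in $V(\Gamma)\setminus C$ is adjacent to exactly one vertex in $C$. A dominating vertex is a vertex adjacent to all other vertices of the graph. A maximal cyclic subgroup of $G$ is a cyclic subgroup not properly contained in any other cyclic subgroup of $G$. -}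

module Defs where

open import Algebra.Bundles using (Group)
open import Data.Fin.Base using (Fin)
open import Data.Nat.Base using (ℕ)
open import Data.Product.Base using (Σ; ∃; _×_; _,_; proj₁; proj₂)
open import Data.Product using (∃!)
open import Data.Sum.Base using (inj₁; inj₂)
open import Function.Base using (_∘_)
open import Function.Bundles using (Inverse)
open import Level using (Level; _⊔_; suc)
open import Relation.Binary.Bundles using (Setoid)
open import Relation.Binary.Core using (Rel)
open import Relation.Binary.Definitions
  using (Symmetric; Irreflexive; _Respects_; _Respects₂_)
import Relation.Binary.Construct.On as On
import Relation.Binary.PropositionalEquality as ≡
open import Relation.Nullary.Negation using (¬_)
open import Relation.Unary using (Pred; _∈_; _∉_; _⊆_; _⊄_; _≐_; _∪_; U)

private
  variable
    c ℓ p v e a : Level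

HasCardinality : Setoid c ℓ → ℕ → Set (c ⊔ ℓ)
HasCardinality S n = Inverse S (≡.setoid (Fin n))

Finite : Setoid c ℓ → Set (c ⊔ ℓ)
Finite S = ∃ λ n → HasCardinality S n

record SimpleGraph (v e a : Level) : Set (suc (v ⊔ e ⊔ a)) where
  infix 4 _~_
  field
    vertices : Setoid v e
  open Setoid vertices public
    using (_≈_; _≉_) renaming (Carrier to Vertex)
  field
    _~_      : Rel Vertex a
    ~-resp-≈ : _~_ Respects₂ _≈_
    ~-sym    : Symmetric _~_
    ~-irrefl : Irreflexive _≈_ _~_

module _ (Γ : SimpleGraph v e a) where
  open SimpleGraph Γ

  record IsPerfectCode (C : Pred Vertex p) : Set (v ⊔ e ⊔ a ⊔ p) where
    field
      resp        : C Respects _≈_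
      independent : ∀ {x y} → x ∈ C → y ∈ C → ¬ (x ~ y)
      perfect     : ∀ {x} → x ∉ C → ∃! _≈_ (λ y → y ∈ C × x ~ y)

  AdmitsPerfectCode : Set (suc (v ⊔ e) ⊔ a)
  AdmitsPerfectCode = Σ (Pred Vertex (v ⊔ e)) IsPerfectCode

  IsDominating : Pred Vertex (v ⊔ e ⊔ a)
  IsDominating x = ∀ y → y ≉ x → x ~ y

  HasDominatingVertex : Set (v ⊔ e ⊔ a)
  HasDominatingVertex = ∃ IsDominating

module _ (G : Group c ℓ) where
  open Group G

  data Generated (S : Pred Carrier p) : Pred Carrier (c ⊔ ℓ ⊔ p) where
    gen  : ∀ {x} → x ∈ S → Generated S x
    unit : Generated S ε
    mul  : ∀ {x y} → Generated S x → Generated S y → Generated S (x ∙ y)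
    inv  : ∀ {x} → Generated S x → Generated S (x ⁻¹)
    resp : ∀ {x y} → x ≈ y → Generated S x → Generated S y

  ⟨_⟩₁ : Carrier → Pred Carrier (c ⊔ ℓ)
  ⟨ x ⟩₁ = Generated (_≈ x)

  ⟨_,_⟩ : Carrier → Carrier → Pred Carrier (c ⊔ ℓ)
  ⟨ x , y ⟩ = Generated ((_≈ x) ∪ (_≈ y))

  -- A subset equal to some ⟨ g ⟩₁ is automatically a subgroup, so this says
  -- "H is a cyclic subgroup".
  IsCyclic : Pred Carrier p → Set (c ⊔ ℓ ⊔ p)
  IsCyclic H = ∃ λ g → H ≐ ⟨ g ⟩₁

  IsCyclicGroup : Set (c ⊔ ℓ)
  IsCyclicGroup = IsCyclic U

  IsMaximalCyclic : Pred Carrier (c ⊔ ℓ) → Set (suc (c ⊔ ℓ))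
  IsMaximalCyclic M =
    IsCyclic M × (∀ (N : Pred Carrier (c ⊔ ℓ)) → IsCyclic N → M ⊄ N)

  HasOrder : Pred Carrier p → ℕ → Set (c ⊔ ℓ ⊔ p)
  HasOrder H = HasCardinality (On.setoid {B = Σ Carrier H} setoid proj₁)

  HasMaximalCyclicSubgroupOfOrder : ℕ → Set (suc (c ⊔ ℓ))
  HasMaximalCyclicSubgroupOfOrder n =
    Σ (Pred Carrier (c ⊔ ℓ)) λ M → IsMaximalCyclic M × HasOrder M n

  Cyc : Pred Carrier (c ⊔ ℓ)
  Cyc x = ∀ y → IsCyclic ⟨ x , y ⟩

  Generated-mono : ∀ {S T : Pred Carrier ℓ} → S ⊆ T → Generated S ⊆ Generated T
  Generated-mono S⊆T (gen s)    = gen (S⊆T s)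
  Generated-mono S⊆T unit       = unit
  Generated-mono S⊆T (mul h k)  = mul (Generated-mono S⊆T h) (Generated-mono S⊆T k)
  Generated-mono S⊆T (inv h)    = inv (Generated-mono S⊆T h)
  Generated-mono S⊆T (resp q h) = resp q (Generated-mono S⊆T h)

  IsCyclic-resp : ∀ {H K : Pred Carrier (c ⊔ ℓ)} →
                  H ⊆ K → K ⊆ H → IsCyclic H → IsCyclic K
  IsCyclic-resp H⊆K K⊆H (g , H⊆g , g⊆H) =
    g , (λ k → H⊆g (K⊆H k)) , (λ k → H⊆K (g⊆H k))

  swap : ∀ {x y} → ⟨ x , y ⟩ ⊆ ⟨ y , x ⟩
  swap = Generated-mono λ { (inj₁ q) → inj₂ q ; (inj₂ q) → inj₁ q }

  substʳ : ∀ {x y z} → y ≈ z → ⟨ x , y ⟩ ⊆ ⟨ x , z ⟩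
  substʳ y≈z = Generated-mono
    λ { (inj₁ q) → inj₁ q ; (inj₂ q) → inj₂ (trans q y≈z) }

  substˡ : ∀ {x y z} → x ≈ z → ⟨ x , y ⟩ ⊆ ⟨ z , y ⟩
  substˡ x≈z = Generated-mono
    λ { (inj₁ q) → inj₁ (trans q x≈z) ; (inj₂ q) → inj₂ q }

  nonCyclicGraph : SimpleGraph (c ⊔ ℓ) ℓ (c ⊔ ℓ)
  nonCyclicGraph = record
    { vertices = On.setoid {B = Σ Carrier (_∉ Cyc)} setoid proj₁
    ; _~_      = λ (x , _) (y , _) → ¬ (x ≈ y) × ¬ IsCyclic ⟨ x , y ⟩
    ; ~-resp-≈ =
        (λ y≈z (x≉y , nc) →
          (λ x≈z → x≉y (trans x≈z (sym y≈z))) ,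
          nc ∘ IsCyclic-resp (substʳ (sym y≈z)) (substʳ y≈z)) ,
        (λ x≈z (x≉y , nc) →
          (λ z≈y → x≉y (trans x≈z z≈y)) ,
          nc ∘ IsCyclic-resp (substˡ (sym x≈z)) (substˡ x≈z))
    ; ~-sym    = λ (x≉y , nc) → x≉y ∘ sym , nc ∘ IsCyclic-resp swap swap
    ; ~-irrefl = λ x≈y (x≉y , _) → x≉y x≈y
    }

{-# OPTIONS --safe #-}
module Submission where

-- The elements of a perfect code C are involutions: for x ∈ C with x⁻¹ ≉ x,
-- both x⁻¹ ∉ C and x⁻¹ ∈ C are impossible, because x and x⁻¹ have the same
-- neighbours (at least one) and are not adjacent.  A cyclic group has at most
-- one involution, so independence leaves C = {x}, and x is dominating.
-- Likewise a dominating vertex x is not adjacent to x⁻¹, hence x² ≈ ε, and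
-- ⟨x⟩ is maximal cyclic because a generator of a larger cyclic subgroup would
-- be a vertex not adjacent to x.
-- Constructively, a code need not be a decidable set; the dominating vertex is
-- found by search, cyclicity of ⟨x,y⟩ being decidable in a finite group.

open import Defs
open import Algebra.Bundles using (Group)
open import Data.Product.Base using (_×_)
open import Function.Bundles using (_⇔_)
open import Level using (Level)
open import Relation.Nullary.Negation using (¬_)

open import Algebra.Properties.Group using (inverseʳ-unique; ⁻¹-involutive)
import Algebra.Properties.Monoid.Mult as Mult
open import Data.Empty using (⊥-elim)
open import Data.Fin.Base using (Fin; zero; suc; toℕ; fromℕ<)
open import Data.Fin.Properties using (all?; any?; pigeonhole; toℕ-fromℕ<) renaming (_≟_ to _≟ᶠ_)
open import Data.List.Base using ([]; _∷_; map; allFin)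
open import Data.List.Membership.Propositional.Properties using (∈-allFin; ∈-map⁺)
open import Data.List.Relation.Unary.All as All using (All; []; _∷_)
open import Data.Nat.Base using (ℕ; zero; suc; _+_; _*_; _∸_)
open import Data.Nat.DivMod using (_/_; _%_; m≡m%n+[m/n]*n; m%n<n)
open import Data.Nat.Divisibility using (_∣_; divides)
open import Data.Nat.GCD using (gcd; gcd[m,n]∣m; gcd[m,n]∣n; gcd-GCD; module Bézout)
import Data.Nat.Properties as ℕₚ
open import Data.Product.Base using (∃; _,_; proj₁; proj₂)
open import Data.Sum.Base using (_⊎_; inj₁; inj₂; [_,_]′)
open import Function.Base using (_∘_)
open import Function.Bundles using (Inverse; mk⇔)
open import Level using (_⊔_; lift; Lift)
open import Relation.Binary.PropositionalEquality as ≡ using (_≡_)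
open import Relation.Nullary.Decidable using (Dec; yes; no; map′; ¬?; _×-dec_; _→-dec_; decidable-stable)
open import Relation.Unary using (Pred; _∈_; _∉_; _⊆_; _⊄_)
import Relation.Binary.Reasoning.Setoid as SetoidReasoning

module _ {c ℓ : Level} (G : Group c ℓ) where
  open Group G
  open Mult monoid using (×-congʳ; ×-homo-+; ×-assocˡ; ×-congˡ) renaming (_×_ to _·_)
  open SetoidReasoning setoid

  -- Subgroups on one and two generators, and when they are cyclic.

  Gen₁ : Carrier → Pred Carrier (c ⊔ ℓ)
  Gen₁ = ⟨_⟩₁ G

  Gen₂ : Carrier → Carrier → Pred Carrier (c ⊔ ℓ)
  Gen₂ = ⟨_,_⟩ G

  Cyclic₂ : Carrier → Carrier → Set (c ⊔ ℓ)
  Cyclic₂ x y = IsCyclic G (Gen₂ x y)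

  Generated-least : ∀ {p q} {S : Pred Carrier p} {T : Pred Carrier q} →
                    S ⊆ Generated G T → Generated G S ⊆ Generated G T
  Generated-least f (gen s)    = f s
  Generated-least f unit       = unit
  Generated-least f (mul h k)  = mul (Generated-least f h) (Generated-least f k)
  Generated-least f (inv h)    = inv (Generated-least f h)
  Generated-least f (resp q h) = resp q (Generated-least f h)

  Gen₁-least : ∀ {p} {T : Pred Carrier p} {x} → x ∈ Generated G T → Gen₁ x ⊆ Generated G T
  Gen₁-least x∈T = Generated-least λ q → resp (sym q) x∈T

  Gen₂-least : ∀ {p} {T : Pred Carrier p} {x y} →
               x ∈ Generated G T → y ∈ Generated G T → Gen₂ x y ⊆ Generated G T
  Gen₂-least x∈T y∈T = Generated-least
    λ { (inj₁ q) → resp (sym q) x∈T ; (inj₂ q) → resp (sym q) y∈T }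

  ∈-Gen₁ : ∀ {x} → x ∈ Gen₁ x
  ∈-Gen₁ = gen refl

  ∈-Gen₂ˡ : ∀ {x y} → x ∈ Gen₂ x y
  ∈-Gen₂ˡ = gen (inj₁ refl)

  ∈-Gen₂ʳ : ∀ {x y} → y ∈ Gen₂ x y
  ∈-Gen₂ʳ = gen (inj₂ refl)

  ·-∈-Generated : ∀ {p} {T : Pred Carrier p} {x} k → x ∈ Generated G T → k · x ∈ Generated G T
  ·-∈-Generated zero    _   = unit
  ·-∈-Generated (suc k) x∈T = mul x∈T (·-∈-Generated k x∈T)

  Cyclic₂-respˡ : ∀ {x x′ y} → x ≈ x′ → Cyclic₂ x y → Cyclic₂ x′ y
  Cyclic₂-respˡ q = IsCyclic-resp G (substˡ G q) (substˡ G (sym q))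

  Cyclic₂-respʳ : ∀ {x y y′} → y ≈ y′ → Cyclic₂ x y → Cyclic₂ x y′
  Cyclic₂-respʳ q = IsCyclic-resp G (substʳ G q) (substʳ G (sym q))

  Cyclic₂-sym : ∀ {x y} → Cyclic₂ x y → Cyclic₂ y x
  Cyclic₂-sym = IsCyclic-resp G (swap G) (swap G)

  Cyclic₂-inv : ∀ {x y} → Cyclic₂ (x ⁻¹) y → Cyclic₂ x y
  Cyclic₂-inv {x} = IsCyclic-resp G
    (Gen₂-least (inv ∈-Gen₂ˡ) ∈-Gen₂ʳ)
    (Gen₂-least (resp (⁻¹-involutive G x) (inv ∈-Gen₂ˡ)) ∈-Gen₂ʳ)

  ∈-Gen₁⇒Cyclic₂ : ∀ {x y} → x ∈ Gen₁ y → Cyclic₂ x y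
  ∈-Gen₁⇒Cyclic₂ {y = y} x∈⟨y⟩ = y , Gen₂-least x∈⟨y⟩ ∈-Gen₁ , Gen₁-least ∈-Gen₂ʳ

  Cyc-resp : ∀ {x y} → x ≈ y → x ∈ Cyc G → y ∈ Cyc G
  Cyc-resp q x∈Cyc y = Cyclic₂-respˡ q (x∈Cyc y)

  Cyc-inv : ∀ {x} → x ⁻¹ ∈ Cyc G → x ∈ Cyc G
  Cyc-inv h y = Cyclic₂-inv (h y)

  ε∈Cyc : ε ∈ Cyc G
  ε∈Cyc y = ∈-Gen₁⇒Cyclic₂ unit

  ∉Cyc⇒≉ε : ∀ {x} → x ∉ Cyc G → ¬ x ≈ ε
  ∉Cyc⇒≉ε x∉Cyc x≈ε = x∉Cyc (Cyc-resp (sym x≈ε) ε∈Cyc)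

  -- Bézout puts gcd(a,b) · w into ⟨a·w, b·w⟩; it divides both generators.
  Cyclic₂-multiples : ∀ w a b → Cyclic₂ (a · w) (b · w)
  Cyclic₂-multiples w a b =
      d · w
    , Gen₂-least (multiple (gcd[m,n]∣m a b)) (multiple (gcd[m,n]∣n a b))
    , Gen₁-least (bézout (Bézout.identity (gcd-GCD a b)))
    where
    d = gcd a b

    multiple : ∀ {k} → d ∣ k → k · w ∈ Gen₁ (d · w)
    multiple (divides q k≡q*d) =
      resp (trans (×-assocˡ w q d) (×-congˡ (≡.sym k≡q*d))) (·-∈-Generated q ∈-Gen₁)

    -- Bézout over ℕ has two sign patterns; leaving `k` and `l` free lets one computation serve
    -- both.
    difference : ∀ {k l x y} → k · w ∈ Gen₂ (a · w) (b · w) → l · w ∈ Gen₂ (a · w) (b · w) →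
                 d + x * k ≡ y * l → d · w ∈ Gen₂ (a · w) (b · w)
    difference {k} {l} {x} {y} k∈ l∈ eq =
      resp d≈ (mul (·-∈-Generated y l∈) (inv (·-∈-Generated x k∈)))
      where
      d≈ : y · (l · w) ∙ (x · (k · w)) ⁻¹ ≈ d · w
      d≈ = begin
        y · (l · w) ∙ (x · (k · w)) ⁻¹              ≈⟨ ∙-congʳ (×-assocˡ w y l) ⟩
        (y * l) · w ∙ (x · (k · w)) ⁻¹              ≈⟨ ∙-congʳ (×-congˡ eq) ⟨
        (d + x * k) · w ∙ (x · (k · w)) ⁻¹          ≈⟨ ∙-congʳ (×-homo-+ w d (x * k)) ⟩
        (d · w ∙ (x * k) · w) ∙ (x · (k · w)) ⁻¹    ≈⟨ ∙-congʳ (∙-congˡ (×-assocˡ w x k)) ⟨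
        (d · w ∙ x · (k · w)) ∙ (x · (k · w)) ⁻¹    ≈⟨ assoc _ _ _ ⟩
        d · w ∙ (x · (k · w) ∙ (x · (k · w)) ⁻¹)    ≈⟨ ∙-congˡ (inverseʳ _) ⟩
        d · w ∙ ε                                   ≈⟨ identityʳ _ ⟩
        d · w                                       ∎

    bézout : Bézout.Identity d a b → d · w ∈ Gen₂ (a · w) (b · w)
    bézout (Bézout.+- x y eq) = difference {x = y} {y = x} ∈-Gen₂ʳ ∈-Gen₂ˡ eq
    bézout (Bézout.-+ x y eq) = difference {x = x} {y = y} ∈-Gen₂ˡ ∈-Gen₂ʳ eq

  -- Involutions.

  involution⇒≈⁻¹ : ∀ {x} → x ∙ x ≈ ε → x ≈ x ⁻¹
  involution⇒≈⁻¹ {x} = inverseʳ-unique G x x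

  ≈⁻¹⇒involution : ∀ {x} → x ≈ x ⁻¹ → x ∙ x ≈ ε
  ≈⁻¹⇒involution {x} x≈x⁻¹ = trans (∙-congˡ x≈x⁻¹) (inverseʳ x)

  Gen₁-involution : ∀ {w y} → w ∙ w ≈ ε → y ∈ Gen₁ w → y ≈ ε ⊎ y ≈ w
  Gen₁-involution w²≈ε (gen q) = inj₂ q
  Gen₁-involution w²≈ε unit    = inj₁ refl
  Gen₁-involution w²≈ε (mul h k) with Gen₁-involution w²≈ε h | Gen₁-involution w²≈ε k
  ... | inj₁ p | inj₁ q = inj₁ (trans (∙-cong p q) (identityˡ ε))
  ... | inj₁ p | inj₂ q = inj₂ (trans (∙-cong p q) (identityˡ _))
  ... | inj₂ p | inj₁ q = inj₂ (trans (∙-cong p q) (identityʳ _))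
  ... | inj₂ p | inj₂ q = inj₁ (trans (∙-cong p q) w²≈ε)
  Gen₁-involution w²≈ε (inv h) with Gen₁-involution w²≈ε h
  ... | inj₁ p = inj₁ (trans (⁻¹-cong p) (sym (involution⇒≈⁻¹ (identityˡ ε))))
  ... | inj₂ p = inj₂ (trans (⁻¹-cong p) (sym (involution⇒≈⁻¹ w²≈ε)))
  Gen₁-involution w²≈ε (resp q h) =
    [ (λ p → inj₁ (trans (sym q) p)) , (λ p → inj₂ (trans (sym q) p)) ]′ (Gen₁-involution w²≈ε h)

  -- Finite groups: exhaustive search and powers of a generator.

  module _ {n : ℕ} (G↔Fin : HasCardinality setoid n) where
    open Inverse G↔Fin using (to; from; to-cong; strictlyInverseʳ)

    to-injective : ∀ {x y} → to x ≡ to y → x ≈ y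
    to-injective {x} {y} q = begin
      x           ≈⟨ strictlyInverseʳ x ⟨
      from (to x) ≡⟨ ≡.cong from q ⟩
      from (to y) ≈⟨ strictlyInverseʳ y ⟩
      y           ∎

    infix 4 _≟_
    _≟_ : ∀ x y → Dec (x ≈ y)
    x ≟ y = map′ to-injective to-cong (to x ≟ᶠ to y)

    module _ {p} {P : Pred Carrier p} (P-resp : ∀ {x y} → x ≈ y → P x → P y) (P? : ∀ x → Dec (P x)) where

      search : Dec (∃ P)
      search = map′ (λ (i , Pi) → from i , Pi)
                    (λ (x , Px) → to x , P-resp (sym (strictlyInverseʳ x)) Px)
                    (any? (P? ∘ from))

      decide-all : Dec (∀ x → P x)
      decide-all = map′ (λ f x → P-resp (strictlyInverseʳ x) (f (to x)))
                        (λ f i → f (from i))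
                        (all? (P? ∘ from))

    -- Two of the `n + 1` powers with exponents 0 to `n` coincide, and cancelling the smaller one
    -- leaves a positive exponent that kills `g`.
    finite-order : ∀ g → ∃ λ m → suc m · g ≈ ε
    finite-order g
      with i , j , i<j , q ← pigeonhole (ℕₚ.n<1+n n) (λ i → to (toℕ i · g)) =
      k , (begin
        suc k · g                                    ≈⟨ identityˡ _ ⟨
        ε ∙ suc k · g                                ≈⟨ ∙-congʳ (inverseˡ _) ⟨
        ((toℕ i · g) ⁻¹ ∙ toℕ i · g) ∙ suc k · g      ≈⟨ assoc _ _ _ ⟩
        (toℕ i · g) ⁻¹ ∙ (toℕ i · g ∙ suc k · g)      ≈⟨ ∙-congˡ (×-homo-+ g (toℕ i) (suc k)) ⟨
        (toℕ i · g) ⁻¹ ∙ (toℕ i + suc k) · g          ≈⟨ ∙-congˡ (×-congˡ i+1+k≡j) ⟩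
        (toℕ i · g) ⁻¹ ∙ toℕ j · g                    ≈⟨ ∙-congˡ (to-injective q) ⟨
        (toℕ i · g) ⁻¹ ∙ toℕ i · g                    ≈⟨ inverseˡ _ ⟩
        ε                                             ∎)
      where
      -- One less than the difference of the exponents, because the result is stated with `suc`.
      k = toℕ j ∸ suc (toℕ i)
      i+1+k≡j : toℕ i + suc k ≡ toℕ j
      i+1+k≡j = ≡.trans (ℕₚ.+-suc (toℕ i) k) (ℕₚ.m+[n∸m]≡n i<j)

    ·-zeroʳ : ∀ k → k · ε ≈ ε
    ·-zeroʳ zero    = refl
    ·-zeroʳ (suc k) = trans (identityˡ _) (·-zeroʳ k)

    -- Exponents in ℕ suffice: `suc m · x ≈ ε` makes `m · x` the inverse of `x`.
    Gen₁⇒multiple : ∀ {g x} → x ∈ Gen₁ g → ∃ λ k → k · g ≈ x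
    Gen₁⇒multiple (gen q) = 1 , trans (identityʳ _) (sym q)
    Gen₁⇒multiple unit    = 0 , refl
    Gen₁⇒multiple {g} (mul h h′) with k , p ← Gen₁⇒multiple h | l , q ← Gen₁⇒multiple h′ =
      k + l , trans (×-homo-+ g k l) (∙-cong p q)
    Gen₁⇒multiple {g} (inv {x} h) with k , p ← Gen₁⇒multiple h | m , q ← finite-order x =
      m * k , trans (sym (×-assocˡ g m k)) (trans (×-congʳ m p) (inverseʳ-unique G x (m · x) q))
    Gen₁⇒multiple (resp q h) with k , p ← Gen₁⇒multiple h = k , trans p q

    Gen₁-comm : ∀ {g x y} → x ∈ Gen₁ g → y ∈ Gen₁ g → x ∙ y ≈ y ∙ x
    Gen₁-comm {g} {x} {y} x∈ y∈
      with k , p ← Gen₁⇒multiple x∈ | l , q ← Gen₁⇒multiple y∈ = begin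
        x ∙ y           ≈⟨ ∙-cong p q ⟨
        k · g ∙ l · g   ≈⟨ ×-homo-+ g k l ⟨
        (k + l) · g     ≈⟨ ×-congˡ (ℕₚ.+-comm k l) ⟩
        (l + k) · g     ≈⟨ ×-homo-+ g l k ⟩
        l · g ∙ k · g   ≈⟨ ∙-cong q p ⟩
        y ∙ x           ∎

    -- If `suc m · g ≈ ε`, exponents matter only modulo `suc m`, so `x` is compared with finitely
    -- many powers.
    _∈Gen₁?_ : ∀ x g → Dec (x ∈ Gen₁ g)
    x ∈Gen₁? g with finite-order g
    ... | m , mg≈ε = map′
      (λ (i , q) → resp q (·-∈-Generated (toℕ i) ∈-Gen₁))
      bounded
      (any? λ (i : Fin (suc m)) → toℕ i · g ≟ x)
      where
      bounded : x ∈ Gen₁ g → ∃ λ (i : Fin (suc m)) → toℕ i · g ≈ x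
      bounded x∈ with k , kg≈x ← Gen₁⇒multiple x∈ =
        fromℕ< (m%n<n k (suc m)) , (begin
          toℕ (fromℕ< (m%n<n k (suc m))) · g    ≈⟨ ×-congˡ (toℕ-fromℕ< (m%n<n k (suc m))) ⟩
          r · g                                 ≈⟨ identityʳ _ ⟨
          r · g ∙ ε                             ≈⟨ ∙-congˡ (·-zeroʳ t) ⟨
          r · g ∙ t · ε                         ≈⟨ ∙-congˡ (×-congʳ t mg≈ε) ⟨
          r · g ∙ t · (suc m · g)               ≈⟨ ∙-congˡ (×-assocˡ g t (suc m)) ⟩
          r · g ∙ (t * suc m) · g               ≈⟨ ×-homo-+ g r (t * suc m) ⟨
          (r + t * suc m) · g                   ≈⟨ ×-congˡ (m≡m%n+[m/n]*n k (suc m)) ⟨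
          k · g                                 ≈⟨ kg≈x ⟩
          x                                     ∎)
        where
        r = k % suc m
        t = k / suc m

    -- Cyclic subgroups and `Cyc` in a finite group.

    Gen₁-Cyclic₂ : ∀ {w x y} → x ∈ Gen₁ w → y ∈ Gen₁ w → Cyclic₂ x y
    Gen₁-Cyclic₂ {w} x∈ y∈
      with a , p ← Gen₁⇒multiple x∈ | b , q ← Gen₁⇒multiple y∈ =
      Cyclic₂-respˡ p (Cyclic₂-respʳ q (Cyclic₂-multiples w a b))

    -- A generator of ⟨z, y⟩ also has `x` among its powers. Read contrapositively, non-cyclicity
    -- with `y` passes from `x` up to `z`.
    Cyclic₂-⊆ : ∀ {x y z} → x ∈ Gen₁ z → Cyclic₂ z y → Cyclic₂ x y
    Cyclic₂-⊆ x∈⟨z⟩ (w , ⊆⟨w⟩ , _) =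
      Gen₁-Cyclic₂ (Gen₁-least (⊆⟨w⟩ ∈-Gen₂ˡ) x∈⟨z⟩) (⊆⟨w⟩ ∈-Gen₂ʳ)

    Cyc-⊆ : ∀ {x z} → x ∈ Gen₁ z → z ∈ Cyc G → x ∈ Cyc G
    Cyc-⊆ x∈⟨z⟩ z∈Cyc y = Cyclic₂-⊆ x∈⟨z⟩ (z∈Cyc y)

    -- Asking that some ⟨w⟩ contain both elements is enough, as subgroups of cyclic groups are
    -- cyclic; this leaves membership tests over finitely many `w`.
    cyclic₂? : ∀ x y → Dec (Cyclic₂ x y)
    cyclic₂? x y = map′
      (λ (w , x∈ , y∈) → Gen₁-Cyclic₂ x∈ y∈)
      (λ (w , ⊆⟨w⟩ , _) → w , ⊆⟨w⟩ ∈-Gen₂ˡ , ⊆⟨w⟩ ∈-Gen₂ʳ)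
      (search
        (λ q (x∈ , y∈) → Gen₁-least (gen q) x∈ , Gen₁-least (gen q) y∈)
        (λ w → (x ∈Gen₁? w) ×-dec (y ∈Gen₁? w)))

    Cyc? : ∀ x → Dec (x ∈ Cyc G)
    Cyc? x = decide-all Cyclic₂-respʳ (cyclic₂? x)

    -- ⟨x, y⟩ is abelian, so all squares in it are trivial once those of the generators are. Its
    -- cyclic generator `w` then has square `ε`, and `w` is the only possible non-identity element.
    Cyclic₂-involutions : ∀ {x y} → Cyclic₂ x y → ¬ x ≈ ε → ¬ y ≈ ε →
                          x ∙ x ≈ ε → y ∙ y ≈ ε → x ≈ y
    Cyclic₂-involutions {x} {y} (w , ⊆⟨w⟩ , ⊇⟨w⟩) x≉ε y≉ε x²≈ε y²≈ε =
      trans (≈w x≉ε (⊆⟨w⟩ ∈-Gen₂ˡ)) (sym (≈w y≉ε (⊆⟨w⟩ ∈-Gen₂ʳ)))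
      where
      square : ∀ {g} → g ∈ Gen₂ x y → g ∙ g ≈ ε
      square (gen (inj₁ q)) = trans (∙-cong q q) x²≈ε
      square (gen (inj₂ q)) = trans (∙-cong q q) y²≈ε
      square unit           = identityˡ ε
      square (mul {g} {h} g∈ h∈) = begin
        (g ∙ h) ∙ (g ∙ h)   ≈⟨ ∙-congˡ (Gen₁-comm (⊆⟨w⟩ g∈) (⊆⟨w⟩ h∈)) ⟩
        (g ∙ h) ∙ (h ∙ g)   ≈⟨ assoc g h (h ∙ g) ⟩
        g ∙ (h ∙ (h ∙ g))   ≈⟨ ∙-congˡ (assoc h h g) ⟨
        g ∙ ((h ∙ h) ∙ g)   ≈⟨ ∙-congˡ (∙-congʳ (square h∈)) ⟩
        g ∙ (ε ∙ g)         ≈⟨ ∙-congˡ (identityˡ g) ⟩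
        g ∙ g               ≈⟨ square g∈ ⟩
        ε                   ∎
      square (inv {g} g∈) = trans (sym (∙-cong g≈g⁻¹ g≈g⁻¹)) (square g∈)
        where
        g≈g⁻¹ = involution⇒≈⁻¹ (square g∈)
      square (resp q g∈) = trans (sym (∙-cong q q)) (square g∈)

      ≈w : ∀ {g} → ¬ g ≈ ε → g ∈ Gen₁ w → g ≈ w
      ≈w g≉ε g∈ = [ (λ p → ⊥-elim (g≉ε p)) , (λ p → p) ]′
        (Gen₁-involution (square (⊇⟨w⟩ ∈-Gen₁)) g∈)

    -- The list is absorbed one element at a time: ⟨g, x⟩ is cyclic because `g` is in `Cyc`, and its
    -- generator replaces `g`. Run over all elements, this shows that `Cyc` cannot be the whole of a
    -- non-cyclic group.
    common-generator : (∀ x → x ∈ Cyc G) → ∀ xs → ∃ λ g → All (_∈ Gen₁ g) xs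
    common-generator all-Cyc []       = ε , []
    common-generator all-Cyc (x ∷ xs)
      with g , xs∈ ← common-generator all-Cyc xs
      with h , ⊆⟨h⟩ , _ ← all-Cyc g x =
      h , ⊆⟨h⟩ ∈-Gen₂ʳ ∷ All.map (Gen₁-least (⊆⟨h⟩ ∈-Gen₂ˡ)) xs∈

    all-Cyc⇒cyclic : (∀ x → x ∈ Cyc G) → IsCyclicGroup G
    all-Cyc⇒cyclic all-Cyc
      with g , ∈⟨g⟩ ← common-generator all-Cyc (map from (allFin n)) =
      g , (λ {x} _ → resp (strictlyInverseʳ x) (All.lookup ∈⟨g⟩ (∈-map⁺ from (∈-allFin (to x))))) , _

    -- Deciding whether the graph has a dominating vertex.

    private
      Γ = nonCyclicGraph G
    open SimpleGraph Γ using (Vertex)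

    -- Vertices are unfolded into group elements so that the search can run over the group. The
    -- inequality in adjacency is left out of the searched predicate and recovered from `y ≉ x`.
    dominating-vertex? : Dec (HasDominatingVertex Γ)
    dominating-vertex? = map′
      (λ (x , x∉Cyc , dom) → (x , x∉Cyc) , λ (y , y∉Cyc) y≉x → y≉x ∘ sym , dom y y∉Cyc y≉x)
      (λ ((x , x∉Cyc) , dom) → x , x∉Cyc , λ y y∉Cyc y≉x → proj₂ (dom (y , y∉Cyc) y≉x))
      (search
        (λ x≈x′ (x∉Cyc , dom) →
          x∉Cyc ∘ Cyc-resp (sym x≈x′) ,
          λ y y∉Cyc y≉x′ → dom y y∉Cyc (λ y≈x → y≉x′ (trans y≈x x≈x′)) ∘ Cyclic₂-respˡ (sym x≈x′))
        (λ x → ¬? (Cyc? x) ×-dec decide-all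
          (λ y≈y′ f y′∉Cyc y′≉x →
            f (y′∉Cyc ∘ Cyc-resp y≈y′) (λ y≈x → y′≉x (trans (sym y≈y′) y≈x)) ∘ Cyclic₂-respʳ (sym y≈y′))
          (λ y → ¬? (Cyc? y) →-dec (¬? (y ≟ x) →-dec ¬? (cyclic₂? x y)))))

    -- From a perfect code to a dominating vertex.

    module _ {p} {C : Pred Vertex p} (perfectCode : IsPerfectCode Γ C) where
      open IsPerfectCode perfectCode using (independent; perfect)

      code-involution : ∀ {x} → x ∈ C → proj₁ x ∙ proj₁ x ≈ ε
      code-involution {x , x∉Cyc} x∈C = ≈⁻¹⇒involution
        (decidable-stable (x ≟ x ⁻¹) λ x≉x⁻¹ → ¬x⁻¹∉C (x≉x⁻¹⇒x⁻¹∉C x≉x⁻¹))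
        where
        x⁻¹ : Vertex
        x⁻¹ = x ⁻¹ , x∉Cyc ∘ Cyc-inv

        -- A code neighbour `c` of `x⁻¹` would also be adjacent to `x`, since ⟨x⁻¹, c⟩ lies in ⟨x,
        -- c⟩; that breaks independence.
        ¬x⁻¹∉C : ¬ (x⁻¹ ∉ C)
        ¬x⁻¹∉C x⁻¹∉C with c , (c∈C , _ , ¬cyc) , _ ← perfect x⁻¹∉C =
          independent x∈C c∈C
            ( (λ x≈c → ¬cyc (∈-Gen₁⇒Cyclic₂ (inv (gen x≈c))))
            , (λ cyc → ¬cyc (Cyclic₂-⊆ (inv ∈-Gen₁) cyc)))

        -- A `w` with ⟨x, w⟩ not cyclic is outside `C` by independence, yet has both `x` and `x⁻¹`
        -- as code neighbours, so uniqueness equates them. Hence no such `w` exists and `x` would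
        -- lie in `Cyc`.
        x≉x⁻¹⇒x⁻¹∉C : ¬ x ≈ x ⁻¹ → x⁻¹ ∉ C
        x≉x⁻¹⇒x⁻¹∉C x≉x⁻¹ x⁻¹∈C = x∉Cyc λ w → decidable-stable (cyclic₂? x w) λ ¬cyc →
          let x≉w = λ x≈w → ¬cyc (∈-Gen₁⇒Cyclic₂ (gen x≈w))
              w≉x⁻¹ = λ w≈x⁻¹ → ¬cyc (Cyclic₂-sym (∈-Gen₁⇒Cyclic₂ (resp (sym w≈x⁻¹) (inv ∈-Gen₁))))
              c , _ , unique = perfect {w , λ w∈Cyc → ¬cyc (Cyclic₂-sym (w∈Cyc x))}
                (λ w∈C → independent x∈C w∈C (x≉w , ¬cyc))
          in x≉x⁻¹ (trans (sym (unique (x∈C , x≉w ∘ sym , ¬cyc ∘ Cyclic₂-sym)))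
               (unique (x⁻¹∈C , w≉x⁻¹ , ¬cyc ∘ Cyclic₂-inv ∘ Cyclic₂-sym)))

      code-unique : ∀ {x y} → x ∈ C → y ∈ C → proj₁ x ≈ proj₁ y
      code-unique {x , x∉Cyc} {y , y∉Cyc} x∈C y∈C = decidable-stable (x ≟ y) λ x≉y →
        independent x∈C y∈C (x≉y , λ cyc → x≉y (Cyclic₂-involutions cyc
          (∉Cyc⇒≉ε x∉Cyc) (∉Cyc⇒≉ε y∉Cyc) (code-involution x∈C) (code-involution y∈C)))

      -- Every other vertex is outside `C`, and its code neighbour can only be `x`.
      code-dominating : ∀ {x} → x ∈ C → IsDominating Γ x
      code-dominating {x} x∈C y y≉x =
        let c , (c∈C , _ , ¬cyc) , _ = perfect {y} (λ y∈C → y≉x (code-unique {y} {x} y∈C x∈C))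
        in y≉x ∘ sym , λ cyc → ¬cyc (Cyclic₂-respʳ (code-unique {x} {c} x∈C c∈C) (Cyclic₂-sym cyc))

      -- Each code vertex dominates, so without a dominating vertex `C` would be empty. A vertex
      -- outside `C` has a neighbour in `C`, so there would be no vertices at all, making `G`
      -- cyclic.
      perfectCode⇒dominating : ¬ IsCyclicGroup G → HasDominatingVertex Γ
      perfectCode⇒dominating noncyclic = decidable-stable dominating-vertex? λ ¬dom →
        noncyclic (all-Cyc⇒cyclic λ x → decidable-stable (Cyc? x) λ x∉Cyc →
          let c , (c∈C , _) , _ = perfect {x , x∉Cyc} (λ x∈C → ¬dom ((x , x∉Cyc) , code-dominating x∈C))
          in ¬dom (c , code-dominating c∈C))

    -- From a dominating vertex to a perfect code.

    dominating⇒perfectCode : HasDominatingVertex Γ → AdmitsPerfectCode Γ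
    dominating⇒perfectCode (x , dom) = C , record
      { resp        = λ q (lift p) → lift (trans (sym q) p)
      ; independent = λ (lift p) (lift q) x~y → proj₁ x~y (trans p (sym q))
      ; perfect     = λ {y} y∉C →
          x , (lift refl , SimpleGraph.~-sym Γ {x} {y} (dom y (y∉C ∘ lift))) , λ (lift p , _) → sym p
      }
      where
      -- `Lift` raises the equality from level `ℓ` to the level that `AdmitsPerfectCode` fixes for
      -- codes.
      C : Pred Vertex (c ⊔ ℓ)
      C y = Lift c (proj₁ y ≈ proj₁ x)

    -- Dominating vertices and maximal cyclic subgroups of order 2.

    dominating-involution : ∀ {x} → IsDominating Γ x → proj₁ x ∙ proj₁ x ≈ ε
    dominating-involution {x , x∉Cyc} dom = ≈⁻¹⇒involution (decidable-stable (x ≟ x ⁻¹) λ x≉x⁻¹ →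
      proj₂ (dom (x ⁻¹ , x∉Cyc ∘ Cyc-inv) (x≉x⁻¹ ∘ sym))
        (Cyclic₂-sym (∈-Gen₁⇒Cyclic₂ (inv ∈-Gen₁))))

    involution-order : ∀ {x} → ¬ x ≈ ε → x ∙ x ≈ ε → HasOrder G (Gen₁ x) 2
    involution-order {x} x≉ε x²≈ε = record
      { to        = λ (y , _) → index y
      ; from      = element
      ; to-cong   = index-cong
      ; from-cong = λ { ≡.refl → refl }
      ; inverse   = (λ {i} q → ≡.trans (index-cong q) (index-element i))
                  , (λ {y} q → trans (reflexive (≡.cong (proj₁ ∘ element) q)) (element-index y))
      }
      where
      -- Comparing with `ε` is enough, since on ⟨x⟩ the only other value is `x`.
      index : Carrier → Fin 2
      index y with y ≟ ε
      ... | yes _ = zero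
      ... | no _  = suc zero

      element : Fin 2 → ∃ (Gen₁ x)
      element zero       = ε , unit
      element (suc zero) = x , ∈-Gen₁

      index-cong : ∀ {y z} → y ≈ z → index y ≡ index z
      index-cong {y} {z} q with y ≟ ε | z ≟ ε
      ... | yes _ | yes _ = ≡.refl
      ... | yes p | no z≉ε = ⊥-elim (z≉ε (trans (sym q) p))
      ... | no y≉ε | yes p = ⊥-elim (y≉ε (trans q p))
      ... | no _ | no _ = ≡.refl

      index-element : ∀ i → index (proj₁ (element i)) ≡ i
      index-element zero with ε ≟ ε
      ... | yes _  = ≡.refl
      ... | no ε≉ε = ⊥-elim (ε≉ε refl)
      index-element (suc zero) with x ≟ ε
      ... | yes p = ⊥-elim (x≉ε p)
      ... | no _  = ≡.refl

      element-index : (y : ∃ (Gen₁ x)) → proj₁ (element (index (proj₁ y))) ≈ proj₁ y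
      element-index (y , y∈) with y ≟ ε
      ... | yes p  = sym p
      ... | no y≉ε = [ (λ p → ⊥-elim (y≉ε p)) , sym ]′ (Gen₁-involution x²≈ε y∈)

    dominating⇒maximalCyclic : HasDominatingVertex Γ → HasMaximalCyclicSubgroupOfOrder G 2
    dominating⇒maximalCyclic ((x , x∉Cyc) , dom) =
        Gen₁ x
      , ((x , (λ h → h) , (λ h → h)) , maximal)
      , involution-order (∉Cyc⇒≉ε x∉Cyc) (dominating-involution {x , x∉Cyc} dom)
      where
      maximal : ∀ (N : Pred Carrier (c ⊔ ℓ)) → IsCyclic G N → Gen₁ x ⊄ N
      maximal N (z , N⊆⟨z⟩ , ⟨z⟩⊆N) (⟨x⟩⊆N , N⊈⟨x⟩) =
        -- `z` is a vertex: were it in `Cyc`, so would be its power `x`.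
        proj₂ (dom (z , x∉Cyc ∘ Cyc-⊆ x∈⟨z⟩) z≉x) (∈-Gen₁⇒Cyclic₂ x∈⟨z⟩)
        where
        x∈⟨z⟩ : x ∈ Gen₁ z
        x∈⟨z⟩ = N⊆⟨z⟩ (⟨x⟩⊆N ∈-Gen₁)
        z≉x : ¬ z ≈ x
        z≉x z≈x = N⊈⟨x⟩ λ h → Gen₁-least (gen z≈x) (N⊆⟨z⟩ h)

    -- The generator `g` of `M` dominates: if ⟨g, y⟩ is cyclic, maximality puts `y` in ⟨g⟩, so `y`
    -- is `g` or the non-vertex `ε`. If `g` were in `Cyc`, the same argument would make ⟨g⟩ all of
    -- `G`.
    maximalCyclic⇒dominating : ¬ IsCyclicGroup G → HasMaximalCyclicSubgroupOfOrder G 2 → HasDominatingVertex Γ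
    maximalCyclic⇒dominating noncyclic (M , ((g , M⊆⟨g⟩ , ⟨g⟩⊆M) , maximal) , M↔Fin) =
      (g , g∉Cyc) , λ (y , y∉Cyc) y≉g → y≉g ∘ sym , λ cyc →
        [ ∉Cyc⇒≉ε y∉Cyc , y≉g ]′ (elements (below cyc))
      where
      open Inverse M↔Fin using () renaming (to to index; strictlyInverseʳ to element-index; from to element)

      index-injective : ∀ {y z} → index y ≡ index z → proj₁ y ≈ proj₁ z
      index-injective {y} {z} q = trans (sym (element-index y))
        (trans (reflexive (≡.cong (proj₁ ∘ element) q)) (element-index z))

      -- Pigeonhole for the indices of `ε`, `g` and a third element of `M`.
      third : ∀ (i j k : Fin 2) → i ≡ j ⊎ k ≡ i ⊎ k ≡ j
      third zero       zero       _          = inj₁ ≡.refl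
      third (suc zero) (suc zero) _          = inj₁ ≡.refl
      third zero       (suc zero) zero       = inj₂ (inj₁ ≡.refl)
      third zero       (suc zero) (suc zero) = inj₂ (inj₂ ≡.refl)
      third (suc zero) zero       zero       = inj₂ (inj₂ ≡.refl)
      third (suc zero) zero       (suc zero) = inj₂ (inj₁ ≡.refl)

      elements : ∀ {y} → y ∈ Gen₁ g → y ≈ ε ⊎ y ≈ g
      elements {y} y∈ with third (index (ε , ⟨g⟩⊆M unit)) (index (g , ⟨g⟩⊆M ∈-Gen₁)) (index (y , ⟨g⟩⊆M y∈))
      -- Here `ε ≈ g`; rather than being refuted from the order, this case yields `g ∙ g ≈ ε`, which
      -- suffices.
      ... | inj₁ q        = Gen₁-involution g²≈ε y∈
        where
        g²≈ε : g ∙ g ≈ ε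
        g²≈ε = trans (sym (∙-cong (index-injective q) (index-injective q))) (identityˡ ε)
      ... | inj₂ (inj₁ q) = inj₁ (index-injective q)
      ... | inj₂ (inj₂ q) = inj₂ (index-injective q)

      -- Otherwise ⟨g, y⟩ would be a cyclic subgroup properly containing `M`. Decidable membership
      -- turns this refutation into a proof.
      below : ∀ {y} → Cyclic₂ g y → y ∈ Gen₁ g
      below {y} cyc = decidable-stable (y ∈Gen₁? g) λ y∉⟨g⟩ →
        maximal (Gen₂ g y) cyc
          ( (λ h → Gen₁-least ∈-Gen₂ˡ (M⊆⟨g⟩ h))
          , (λ ⟨g,y⟩⊆M → y∉⟨g⟩ (M⊆⟨g⟩ (⟨g,y⟩⊆M ∈-Gen₂ʳ))))

      g∉Cyc : g ∉ Cyc G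
      g∉Cyc g∈Cyc = noncyclic (g , (λ {y} _ → below (g∈Cyc y)) , _)

theorem4p2 : ∀ {c ℓ : Level} (G : Group c ℓ) → Finite (Group.setoid G) → ¬ IsCyclicGroup G →
    (AdmitsPerfectCode (nonCyclicGraph G) ⇔ HasDominatingVertex (nonCyclicGraph G)) ×
    (HasDominatingVertex (nonCyclicGraph G) ⇔ HasMaximalCyclicSubgroupOfOrder G 2)
theorem4p2 G (_ , G↔Fin) noncyclic =
    mk⇔ (λ (_ , code) → perfectCode⇒dominating G G↔Fin code noncyclic) (dominating⇒perfectCode G G↔Fin)
  , mk⇔ (dominating⇒maximalCyclic G G↔Fin) (maximalCyclic⇒dominating G G↔Fin noncyclic)
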